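{- For $n\ge 1$ and $0\le p\le n-1$, let $C_{n,p}$ be the number of configurations of size $n$ in which exactly $p$ of the other $n-1$ pairs are contained by the given pair. Then $$C(y,z):=\sum_{n\geq 1}\sum_{p=0}^{n-1} C_{n,p}\, y^p \,\frac{z^n}{n!}=\frac{\sqrt{1-2yz}-\sqrt{1-2z}}{(1-2z)(1-y)}.$$
   Context: Fix $n\ge1$. A configuration (of size $n$) is a perfect matching of the $2n$ points $1,2,\dots,2n$ (laid out on a line) into $n$ unordered pairs, together with one distinguished pair, called the given pair; the other $n-1$ pairs are treated as indistinguishable, so there are $n\,(2n-1)!!$ configurations. Let the given pair be $\{g<h\}$ and let $\{a<b\}$ be another pair. The pair $\{a,b\}$ is contained by the given pair if $g<a<b<h$. -}

module Defs where

open import Data.Nat using (ℕ; zero; suc; _∸_; _<_; _≤_; _≤?_; _<?_; _!)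
open import Data.Nat.Properties using (_!≢0)
open import Data.Integer using (+_)
open import Data.Rational using (ℚ; _/_; 0ℚ; 1ℚ) renaming (_+_ to _+ℚ_; _*_ to _*ℚ_; -_ to -ℚ_)
open import Data.Product using (_×_; _,_; proj₁; proj₂)
open import Data.List using (List; []; _∷_; [_]; map; concatMap; length; filter; upTo)
open import Relation.Nullary using (Dec; yes; no; _×-dec_)
open import Relation.Binary.PropositionalEquality using (_≡_)

select : List ℕ → List (ℕ × List ℕ)
select [] = []
select (y ∷ ys) = (y , ys) ∷ map (λ q → proj₁ q , y ∷ proj₂ q) (select ys)

-- perfect matchings of a list of points (fuel = number of pairs);
-- the first point is paired with some later point, then recurse.
-- For a strictly increasing list each matching is listed exactly once,
-- as a list of pairs (a , b) with a < b.
matchingsOf : ℕ → List ℕ → List (List (ℕ × ℕ))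
matchingsOf _ [] = [ [] ]
matchingsOf zero (_ ∷ _) = []
matchingsOf (suc k) (x ∷ xs) =
  concatMap (λ q → map ((x , proj₁ q) ∷_) (matchingsOf k (proj₂ q))) (select xs)

points : ℕ → List ℕ
points n = map suc (upTo (n Data.Nat.+ n))

matchings : ℕ → List (List (ℕ × ℕ))
matchings n = matchingsOf n (points n)

configurations : ℕ → List ((ℕ × ℕ) × List (ℕ × ℕ))
configurations n = concatMap (λ M → map (λ g → g , M) M) (matchings n)

contained? : (gh ab : ℕ × ℕ) → Dec (proj₁ gh < proj₁ ab × proj₂ ab < proj₂ gh)
contained? (g , h) (a , b) = (g <? a) ×-dec (b <? h)

-- number of pairs of the matching contained by the given pair
-- (the given pair itself is never contained by itself)
numContained : (ℕ × ℕ) × List (ℕ × ℕ) → ℕ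
numContained (gh , M) = length (filter (contained? gh) M)

C : ℕ → ℕ → ℕ
C n p = length (filter (λ c → numContained c Data.Nat.≟ p) (configurations n))

-- Formal power series in two variables y , z over ℚ
-- F i j = coefficient of y^i z^j

PS : Set
PS = ℕ → ℕ → ℚ

sumTo : ℕ → (ℕ → ℚ) → ℚ
sumTo zero f = f 0
sumTo (suc n) f = sumTo n f +ℚ f (suc n)

_⊕_ : PS → PS → PS
(F ⊕ G) i j = F i j +ℚ G i j

_⊖_ : PS → PS → PS
(F ⊖ G) i j = F i j +ℚ (-ℚ G i j)

_⊛_ : PS → PS → PS
(F ⊛ G) i j = sumTo i (λ a → sumTo j (λ b → F a b *ℚ G (i ∸ a) (j ∸ b)))

const : ℚ → PS
const c zero zero = c
const c _ _ = 0ℚ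

oneS : PS
oneS = const 1ℚ

twoS : PS
twoS = const (+ 2 / 1)

yS : PS
yS 1 0 = 1ℚ
yS _ _ = 0ℚ

zS : PS
zS 0 1 = 1ℚ
zS _ _ = 0ℚ

_≈S_ : PS → PS → Set
F ≈S G = ∀ i j → F i j ≡ G i j

IsSqrt : PS → PS → Set
IsSqrt S F = (S 0 0 ≡ 1ℚ) × ((S ⊛ S) ≈S F)

Cgf : PS
Cgf p n with (1 ≤? n) ×-dec (p <? n)
... | yes _ = (+ C n p / (n !)) {{n !≢0}}
... | no _ = 0ℚ

{-# OPTIONS --safe #-}

-- If the given pair {g < h} contains the first point, then the pairs it contains are those of a matching
-- of the other 2n points (in size n + 1) lying to the left of h.  Otherwise the first point and its partner
-- can be removed.  Hence C(n+1, p) = D(n, p) + (2n + 1) C(n, p), where D(n, p) counts the matchings of 2n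
-- points with a cut in one of the 2n + 1 gaps and exactly p pairs to the left of the cut.  Removing the last
-- point and its partner from a matching with a cut gives D(n, p) = 2n D(n-1, p) for p < n, whence
-- D(n, p) = C(n, p) + (2n − 1)!! for p ≤ n, that is C(n+1, p) = 2(n + 1) C(n, p) + (2n − 1)!!.
-- This determines (1 − 2z)(1 − y) C(y, z).  On the other side, the Euler operators y∂/∂y and z∂/∂z,
-- applied to S² = F and multiplied by S, give 2F ∂S = S ∂F, a first-order recurrence for the coefficients
-- of S: those of degree n + 1 in z are -(2n − 1)!! / (n + 1)! on the support.
module Submission where

open import Defs
open import Data.Product using (_×_; _,_; proj₁; proj₂)
open import Algebra.Bundles using (CommutativeRing)
open import Level using (0ℓ)
import Algebra.Construct.Pointwise as Pointwise
import Algebra.Properties.CommutativeSemigroup as CommutativeSemigroupProperties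
import Algebra.Properties.Ring

-- Identities in a commutative ring.

module CommutativeRingLemmas (R : CommutativeRing 0ℓ 0ℓ) where

  open CommutativeRing R
  open Algebra.Properties.Ring ring using ([y-z]x≈yx-zx)
  open CommutativeSemigroupProperties *-commutativeSemigroup using (xy∙z≈yz∙x; xy∙z≈xz∙y)

  -- The primes stand for derivatives, of which only the product rule for `s * s` is needed.
  -- Multiplying that rule by `s` makes `s * s` appear in both summands, where it is replaced by
  -- `f`.
  sqrt-derivation : ∀ {s f s′ f′} → s * s ≈ f → s′ * s + s * s′ ≈ f′ → f * s′ + f * s′ ≈ f′ * s
  sqrt-derivation {s} {f} {s′} s²≈f h = trans
    (+-cong (*-congʳ (sym s²≈f)) (*-congʳ (sym s²≈f))) (trans (rearrange s s′) (*-congʳ h))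
    where
    rearrange : ∀ s s′ → s * s * s′ + s * s * s′ ≈ (s′ * s + s * s′) * s
    rearrange s s′ = sym (trans (distribʳ s (s′ * s) (s * s′))
      (+-cong (xy∙z≈yz∙x s′ s s) (xy∙z≈xz∙y s s′ s)))

  [1-x]*g : ∀ x g → (1# - x) * g ≈ g - x * g
  [1-x]*g x g = trans ([y-z]x≈yx-zx g 1# x) (+-congʳ (*-identityˡ g))

-- Formal power series over a commutative ring.

module Series (R : CommutativeRing 0ℓ 0ℓ) where

  open import Data.Nat using (ℕ; zero; suc)
  open CommutativeRing R hiding (zero)
  open import Relation.Binary.Reasoning.Setoid setoid
  open CommutativeSemigroupProperties +-commutativeSemigroup using (interchange; x∙yz≈y∙xz)

  shift : (ℕ → Carrier) → ℕ → Carrier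
  shift f n = f (suc n)

  infix 4 _≋_
  _≋_ : (f g : ℕ → Carrier) → Set
  f ≋ g = ∀ n → f n ≈ g n

  infixl 7 _✶_
  -- The Cauchy product, by recursion on the degree so that the ring laws are plain inductions.
  _✶_ : (f g : ℕ → Carrier) → ℕ → Carrier
  (f ✶ g) zero    = f 0 * g 0
  (f ✶ g) (suc n) = f 0 * g (suc n) + (shift f ✶ g) n

  infixl 6 _✚_
  _✚_ : (f g : ℕ → Carrier) → ℕ → Carrier
  (f ✚ g) n = f n + g n

  𝟙 : ℕ → Carrier
  𝟙 zero    = 1#
  𝟙 (suc _) = 0#

  ✶-cong : ∀ {f f′ g g′} → f ≋ f′ → g ≋ g′ → f ✶ g ≋ f′ ✶ g′
  ✶-cong hf hg zero    = *-cong (hf 0) (hg 0)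
  ✶-cong hf hg (suc n) = +-cong (*-cong (hf 0) (hg (suc n))) (✶-cong (λ m → hf (suc m)) hg n)

  ✶-zeroˡ : ∀ f → (λ _ → 0#) ✶ f ≋ (λ _ → 0#)
  ✶-zeroˡ f zero    = zeroˡ (f 0)
  ✶-zeroˡ f (suc n) = trans (+-cong (zeroˡ _) (✶-zeroˡ f n)) (+-identityˡ 0#)

  -- With `✶-tail` this evaluates products with monomials: `✶-tail` strips leading zeros until only
  -- a constant term is left.
  ✶-head : ∀ {f} g → (∀ n → f (suc n) ≈ 0#) → f ✶ g ≋ (λ n → f 0 * g n)
  ✶-head g h zero    = refl
  ✶-head g h (suc n) = trans (+-congˡ (trans (✶-cong h (λ _ → refl) n) (✶-zeroˡ g n))) (+-identityʳ _)

  ✶-tail : ∀ {f} g → f 0 ≈ 0# → ∀ n → (f ✶ g) (suc n) ≈ (shift f ✶ g) n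
  ✶-tail g h n = trans (+-congʳ (trans (*-congʳ h) (zeroˡ _))) (+-identityˡ _)

  ✶-identityˡ : ∀ f → 𝟙 ✶ f ≋ f
  ✶-identityˡ f n = trans (✶-head f (λ _ → refl) n) (*-identityˡ (f n))

  -- Mirror image of the defining recursion, with the leading coefficient of `g` split off;
  -- commutativity is then an induction that plays the two recursions against each other.
  ✶-shiftʳ : ∀ f g n → (f ✶ g) (suc n) ≈ g 0 * f (suc n) + (f ✶ shift g) n
  ✶-shiftʳ f g zero    = trans (+-comm _ _) (+-congʳ (*-comm _ _))
  ✶-shiftʳ f g (suc n) = begin
      f 0 * g (suc (suc n)) + (shift f ✶ g) (suc n)
    ≈⟨ +-congˡ (✶-shiftʳ (shift f) g n) ⟩
      f 0 * g (suc (suc n)) + (g 0 * f (suc (suc n)) + (shift f ✶ shift g) n)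
    ≈⟨ x∙yz≈y∙xz _ _ _ ⟩
      g 0 * f (suc (suc n)) + (f 0 * g (suc (suc n)) + (shift f ✶ shift g) n) ∎

  ✶-comm : ∀ f g → f ✶ g ≋ g ✶ f
  ✶-comm f g zero    = *-comm _ _
  ✶-comm f g (suc n) = trans (+-congˡ (✶-comm (shift f) g n)) (sym (✶-shiftʳ g f n))

  ✶-distribʳ : ∀ h f g → (f ✚ g) ✶ h ≋ f ✶ h ✚ g ✶ h
  ✶-distribʳ h f g zero    = distribʳ _ _ _
  ✶-distribʳ h f g (suc n) = trans (+-cong (distribʳ _ _ _) (✶-distribʳ h (shift f) (shift g) n)) (interchange _ _ _ _)

  ✶-distribˡ : ∀ h f g → h ✶ (f ✚ g) ≋ h ✶ f ✚ h ✶ g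
  ✶-distribˡ h f g n = trans (✶-comm h (f ✚ g) n)
    (trans (✶-distribʳ h f g n) (+-cong (✶-comm f h n) (✶-comm g h n)))

  ✶-scale : ∀ a f g → (λ n → a * f n) ✶ g ≋ (λ n → a * (f ✶ g) n)
  ✶-scale a f g zero    = *-assoc _ _ _
  ✶-scale a f g (suc n) = trans (+-cong (*-assoc _ _ _) (✶-scale a (shift f) g n)) (sym (distribˡ _ _ _))

  ✶-assoc : ∀ f g h → (f ✶ g) ✶ h ≋ f ✶ (g ✶ h)
  ✶-assoc f g h zero    = *-assoc _ _ _
  ✶-assoc f g h (suc n) = begin
      -- The shift of `f ✶ g` is by definition a sum of two series, so distributivity applies to it.
      f 0 * g 0 * h (suc n) + (((λ m → f 0 * shift g m) ✚ shift f ✶ g) ✶ h) n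
    ≈⟨ +-cong (*-assoc _ _ _) (✶-distribʳ h (λ m → f 0 * shift g m) (shift f ✶ g) n) ⟩
      f 0 * (g 0 * h (suc n)) + (((λ m → f 0 * shift g m) ✶ h) n + ((shift f ✶ g) ✶ h) n)
    ≈⟨ +-congˡ (+-cong (✶-scale (f 0) (shift g) h n) (✶-assoc (shift f) g h n)) ⟩
      f 0 * (g 0 * h (suc n)) + (f 0 * (shift g ✶ h) n + (shift f ✶ (g ✶ h)) n)
    ≈⟨ sym (+-assoc _ _ _) ⟩
      f 0 * (g 0 * h (suc n)) + f 0 * (shift g ✶ h) n + (shift f ✶ (g ✶ h)) n
    ≈⟨ +-congʳ (sym (distribˡ _ _ _)) ⟩
      (f ✶ (g ✶ h)) (suc n) ∎

  seriesRing : CommutativeRing 0ℓ 0ℓ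
  seriesRing = record
    { Carrier = ℕ → Carrier
    ; _≈_ = _≋_
    ; _+_ = _✚_
    ; _*_ = _✶_
    ; -_ = λ f n → - f n
    ; 0# = λ _ → 0#
    ; 1# = 𝟙
    ; isCommutativeRing = record
      { isRing = record
        { +-isAbelianGroup = Pointwise.isAbelianGroup ℕ +-isAbelianGroup
        ; *-cong = ✶-cong
        ; *-assoc = ✶-assoc
        ; *-identity = ✶-identityˡ , λ f n → trans (✶-comm f 𝟙 n) (✶-identityˡ f n)
        ; distrib = ✶-distribˡ , ✶-distribʳ
        }
      ; *-comm = ✶-comm
      }
    }

open import Function using (_∘_; id)
open import Relation.Binary.PropositionalEquality hiding ([_])
open import Relation.Nullary using (yes; no; _×-dec_)

-- Recursions for matchings of points on a line with a cut.

module Counting where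

  open import Data.Nat
  open import Data.Nat.Properties
  open import Data.Nat.ListAction using (sum)
  open import Data.Nat.ListAction.Properties using (sum-++)
  open import Data.Nat.Tactic.RingSolver using (solve-∀)
  open import Data.List using (List; []; _∷_; [_]; _++_; _∷ʳ_; map; concatMap; length; filter; upTo)
  open import Data.List.Properties using (map-++; length-++; length-map; filter-accept; filter-reject; ++-assoc; length-upTo)
  open import Data.List.Relation.Unary.All as All using (All; []; _∷_)
  import Data.List.Relation.Unary.All.Properties as Allₚ
  open import Data.List.Relation.Unary.AllPairs using (AllPairs; []; _∷_)
  import Data.List.Relation.Unary.AllPairs.Properties as AllPairsₚ

  -- The effect on a distribution in `p` of one further pair that is certain to be counted:
  -- multiplication by the variable marking `p`.
  up : (ℕ → ℕ) → ℕ → ℕ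
  up f zero    = 0
  up f (suc p) = f p

  -- Kronecker's delta, written so that `δ (suc m)` computes to `up (δ m)`: each counted pair
  -- becomes one `up`.
  δ : ℕ → ℕ → ℕ
  δ zero    zero    = 1
  δ zero    (suc _) = 0
  δ (suc m) p       = up (δ m) p

  -- The number of perfect matchings of j + r points on a line with exactly p pairs among the first j;
  -- the recursion is on the partner of the first point (see inside-first).
  inside : ℕ → ℕ → ℕ → ℕ
  inside zero          zero          p = δ 0 p
  inside zero          (suc zero)    p = 0
  inside zero          (suc (suc r)) p = suc r * inside zero r p
  inside (suc zero)    zero          p = 0
  inside (suc zero)    (suc r)       p = suc r * inside zero r p
  inside (suc (suc j)) zero          p = suc j * up (inside j zero) p
  inside (suc (suc j)) (suc r)       p = suc j * up (inside j (suc r)) p + suc r * inside (suc j) r p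

  -- The truncation in `pred` is harmless here and below: wherever it takes effect, the accompanying
  -- factor is 0.
  inside-suffix : ∀ r p → inside 0 (suc r) p ≡ r * inside 0 (pred r) p
  inside-suffix zero    p = refl
  inside-suffix (suc r) p = refl

  -- The partner of the first point is one of the other `j` points before the cut, and then the pair
  -- is counted, or one of the `r` points behind it.
  inside-first : ∀ j r p → inside (suc j) r p ≡ j * up (inside (pred j) r) p + r * inside j (pred r) p
  inside-first zero    zero    p = refl
  inside-first zero    (suc r) p = refl
  inside-first (suc j) zero    p = sym (+-identityʳ _)
  inside-first (suc j) (suc r) p = refl

  -- The recursion on the partner of the last point instead.
  LastPoint : ℕ → Set
  LastPoint j = ∀ r p → inside j (suc r) p ≡ j * inside (pred j) r p + r * inside j (pred r) p

  last-up : ∀ j → LastPoint j → ∀ r p →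
    up (inside j (suc r)) p ≡ j * up (inside (pred j) r) p + r * up (inside j (pred r)) p
  last-up j h r zero    = sym (cong₂ _+_ (*-zeroʳ j) (*-zeroʳ r))
  last-up j h r (suc p) = h r p

  -- The factor `j` is kept so that the recursion can be applied without a case distinction: at
  -- `j = 0` both sides vanish. The factor `r` in `r*inside` serves the same end.
  j*inside : ∀ j r p →
    j * inside j r p ≡ j * (pred j * up (inside (pred (pred j)) r) p + r * inside (pred j) (pred r) p)
  j*inside zero    r p = refl
  j*inside (suc j) r p = cong (suc j *_) (inside-first j r p)

  r*inside : ∀ j → LastPoint j → ∀ r p →
    r * inside j r p ≡ r * (j * inside (pred j) (pred r) p + pred r * inside j (pred (pred r)) p)
  r*inside j h zero    p = refl
  r*inside j h (suc r) p = cong (suc r *_) (h r p)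

  r*inside-first : ∀ j r p →
    r * inside (suc j) (pred r) p ≡ r * (j * up (inside (pred j) (pred r)) p + pred r * inside j (pred (pred r)) p)
  r*inside-first j r p = cong (r *_) (inside-first j (pred r) p)

  -- Removing the first point and then the last gives the same terms as the opposite order. `E` is
  -- the case where the two are paired with each other; `X`, `Y`, `Z`, `W` are the choices of a side
  -- of the cut for their two partners.
  last-step : ∀ j → LastPoint j → LastPoint (pred j) → LastPoint (suc j)
  last-step j h h′ r p = begin
      inside (suc j) (suc r) p
    ≡⟨ inside-first j (suc r) p ⟩
      j * up (inside (pred j) (suc r)) p + (E + r * E)
    ≡⟨ cong₂ (λ u v → j * u + (E + v)) (last-up (pred j) h′ r p) (r*inside j h r p) ⟩
      j * (pred j * X + r * Y) + (E + r * (j * Z + pred r * W))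
    ≡⟨ shuffle j r (pred j) (pred r) X Y Z W E ⟩
      (E + j * (pred j * X + r * Z)) + r * (j * Y + pred r * W)
    ≡⟨ sym (cong₂ (λ u v → (E + u) + v) (j*inside j r p) (r*inside-first j r p)) ⟩
      suc j * inside j r p + r * inside (suc j) (pred r) p ∎
    where
    open ≡-Reasoning
    E = inside j r p
    X = up (inside (pred (pred j)) r) p
    Y = up (inside (pred j) (pred r)) p
    Z = inside (pred j) (pred r) p
    W = inside j (pred (pred r)) p
    shuffle : ∀ j r j′ r′ X Y Z W E →
      j * (j′ * X + r * Y) + (E + r * (j * Z + r′ * W)) ≡
      (E + j * (j′ * X + r * Z)) + r * (j * Y + r′ * W)
    shuffle = solve-∀

  inside-last : ∀ j → LastPoint j
  inside-last zero          = inside-suffix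
  -- As `pred 0` is 0, both induction hypotheses are the case `j = 0`.
  inside-last (suc zero)    = last-step 0 inside-suffix inside-suffix
  inside-last (suc (suc j)) = last-step (suc j) (inside-last (suc j)) (inside-last j)

  -- Its terms are `inside (j + i) (l - 1 - i) p` for 0 ≤ i < l: the number of points is fixed and
  -- the cut moves to the right.
  antidiagonal : ℕ → ℕ → ℕ → ℕ
  antidiagonal j zero    p = 0
  antidiagonal j (suc l) p = inside j l p + antidiagonal (suc j) l p

  -- `inside-last` is applied to every term but the final one, whose cut has no point behind it.
  -- Each `inside (j + i) (l - 1 - i) p` then arises twice, with factors l - i and j + i + 1, which
  -- add up to j + l + 1; the first term leaves a boundary contribution.
  antidiagonal-rec : ∀ j l p →
    antidiagonal j (suc (suc l)) p ≡ j * inside (pred j) l p + suc (j + l) * antidiagonal j l p + inside (suc (j + l)) 0 p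
  antidiagonal-rec j zero p = begin
      inside j 1 p + (inside (suc j) 0 p + 0)
    ≡⟨ cong₂ (λ u v → u + v) (inside-last j 0 p) (+-identityʳ _) ⟩
      (j * inside (pred j) 0 p + 0) + inside (suc j) 0 p
    ≡⟨ cong₂ (λ u v → j * inside (pred j) 0 p + u + inside (suc v) 0 p) (sym (*-zeroʳ (suc (j + 0)))) (sym (+-identityʳ j)) ⟩
      j * inside (pred j) 0 p + suc (j + 0) * 0 + inside (suc (j + 0)) 0 p ∎
    where open ≡-Reasoning
  antidiagonal-rec j (suc l) p = begin
      inside j (suc (suc l)) p + antidiagonal (suc j) (suc (suc l)) p
    ≡⟨ cong₂ _+_ (inside-last j (suc l) p) (antidiagonal-rec (suc j) l p) ⟩
      j * inside (pred j) (suc l) p + suc l * inside j l p +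
        (suc j * inside j l p + suc (suc j + l) * antidiagonal (suc j) l p + inside (suc (suc j + l)) 0 p)
    ≡⟨ shuffle j l (inside (pred j) (suc l) p) (inside j l p) (antidiagonal (suc j) l p) (inside (suc (suc j + l)) 0 p) ⟩
      j * inside (pred j) (suc l) p + suc (suc j + l) * antidiagonal j (suc l) p + inside (suc (suc j + l)) 0 p
    ≡⟨ cong (λ v → j * inside (pred j) (suc l) p + suc v * antidiagonal j (suc l) p + inside (suc v) 0 p) (sym (+-suc j l)) ⟩
      j * inside (pred j) (suc l) p + suc (j + suc l) * antidiagonal j (suc l) p + inside (suc (j + suc l)) 0 p ∎
    where
    open ≡-Reasoning
    shuffle : ∀ j l u v w x →
      j * u + suc l * v + (suc j * v + suc (suc j + l) * w + x) ≡
      j * u + suc (suc j + l) * (v + w) + x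
    shuffle = solve-∀

  -- (2m − 1)!!
  oddFactorial : ℕ → ℕ
  oddFactorial zero    = 1
  oddFactorial (suc m) = suc (m + m) * oddFactorial m

  inside-all : ∀ m → inside (m + m) 0 m ≡ oddFactorial m
  inside-all zero    = refl
  inside-all (suc m) rewrite +-suc m m = cong (suc (m + m) *_) (inside-all m)

  inside-all-≢ : ∀ m p → p ≢ m → inside (m + m) 0 p ≡ 0
  inside-all-≢ zero    zero    h with () ← h refl
  inside-all-≢ zero    (suc p) h = refl
  inside-all-≢ (suc m) p       h rewrite +-suc m m with p
  ... | zero  = *-zeroʳ (m + m)
  ... | suc q = trans (cong (suc (m + m) *_) (inside-all-≢ m q (h ∘ cong suc))) (*-zeroʳ (m + m))

  -- D(m, p): the cut after the first j points, 0 ≤ j ≤ 2m, contributes inside j (2m − j) p.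
  cuts : ℕ → ℕ → ℕ
  cuts m p = antidiagonal 0 (suc (m + m)) p

  -- At `j = 0` the front boundary term of `antidiagonal-rec` has factor 0; the cut behind all
  -- points remains as the last summand.
  cuts-rec : ∀ m p → cuts (suc m) p ≡ suc (suc (m + m)) * cuts m p + inside (suc m + suc m) 0 p
  cuts-rec m p rewrite +-suc m m = antidiagonal-rec 0 (suc (m + m)) p

  -- `C` in recursive form, see `C≡config`. The summands separate whether or not the given pair
  -- contains the first point.
  config : ℕ → ℕ → ℕ
  config zero    p = 0
  config (suc m) p = cuts m p + suc (m + m) * config m p

  cuts-zero : ∀ m p → m < p → cuts m p ≡ 0
  cuts-zero zero    (suc p) h = refl
  cuts-zero (suc m) p       h = begin
      cuts (suc m) p
    ≡⟨ cuts-rec m p ⟩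
      suc (suc (m + m)) * cuts m p + inside (suc m + suc m) 0 p
    ≡⟨ cong₂ (λ u v → suc (suc (m + m)) * u + v) (cuts-zero m p (<-trans (n<1+n m) h))
         (inside-all-≢ (suc m) p (<⇒≢ h ∘ sym)) ⟩
      suc (suc (m + m)) * 0 + 0
    ≡⟨ +-identityʳ _ ⟩
      suc (suc (m + m)) * 0
    ≡⟨ *-zeroʳ (suc (suc (m + m))) ⟩
      0 ∎
    where open ≡-Reasoning

  config-zero : ∀ m p → m ≤ p → config m p ≡ 0
  config-zero zero    p h = refl
  config-zero (suc m) p h = begin
      cuts m p + suc (m + m) * config m p
    ≡⟨ cong₂ (λ u v → u + suc (m + m) * v) (cuts-zero m p h) (config-zero m p (<⇒≤ h)) ⟩
      suc (m + m) * 0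
    ≡⟨ *-zeroʳ (suc (m + m)) ⟩
      0 ∎
    where open ≡-Reasoning

  cuts≡config+oddFactorial : ∀ m p → p ≤ m → cuts m p ≡ config m p + oddFactorial m
  cuts≡config+oddFactorial zero    zero z≤n = refl
  cuts≡config+oddFactorial (suc m) p    h with p ≟ suc m
  -- All pairs lie left of the cut, so only the cut behind all points counts; a given pair cannot
  -- contain that many others, so `config` is 0.
  ... | yes refl = begin
      cuts (suc m) (suc m)
    ≡⟨ cuts-rec m (suc m) ⟩
      suc (suc (m + m)) * cuts m (suc m) + inside (suc m + suc m) 0 (suc m)
    ≡⟨ cong₂ (λ u v → suc (suc (m + m)) * u + v) (cuts-zero m (suc m) ≤-refl) (inside-all (suc m)) ⟩
      suc (suc (m + m)) * 0 + oddFactorial (suc m)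
    ≡⟨ cong (_+ oddFactorial (suc m)) (*-zeroʳ (suc (suc (m + m)))) ⟩
      oddFactorial (suc m)
    ≡⟨ cong (_+ oddFactorial (suc m)) (sym (config-zero (suc m) (suc m) ≤-refl)) ⟩
      config (suc m) (suc m) + oddFactorial (suc m) ∎
    where open ≡-Reasoning
  ... | no p≢ = begin
      cuts (suc m) p
    ≡⟨ cuts-rec m p ⟩
      suc (suc (m + m)) * cuts m p + inside (suc m + suc m) 0 p
    ≡⟨ cong (suc (suc (m + m)) * cuts m p +_) (inside-all-≢ (suc m) p p≢) ⟩
      cuts m p + suc (m + m) * cuts m p + 0
    -- Of the 2m + 2 copies of `cuts m p` one is kept and 2m + 1 are replaced by the induction
    -- hypothesis; these are the coefficients in the recursions of `config` and `oddFactorial`.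
    ≡⟨ cong (λ u → cuts m p + suc (m + m) * u + 0) (cuts≡config+oddFactorial m p (s≤s⁻¹ (≤∧≢⇒< h p≢))) ⟩
      cuts m p + suc (m + m) * (config m p + oddFactorial m) + 0
    ≡⟨ shuffle (cuts m p) (suc (m + m)) (config m p) (oddFactorial m) ⟩
      config (suc m) p + oddFactorial (suc m) ∎
    where
    open ≡-Reasoning
    shuffle : ∀ a n x y → a + n * (x + y) + 0 ≡ a + n * x + n * y
    shuffle = solve-∀

  config-rec : ∀ m p → p ≤ m → config (suc m) p ≡ (suc m + suc m) * config m p + oddFactorial m
  config-rec m p h = begin
      cuts m p + suc (m + m) * config m p
    ≡⟨ cong (_+ suc (m + m) * config m p) (cuts≡config+oddFactorial m p h) ⟩
      config m p + oddFactorial m + suc (m + m) * config m p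
    ≡⟨ shuffle m (config m p) (oddFactorial m) ⟩
      (suc m + suc m) * config m p + oddFactorial m ∎
    where
    open ≡-Reasoning
    shuffle : ∀ m x y → x + y + suc (m + m) * x ≡ (suc m + suc m) * x + y
    shuffle = solve-∀

  -- Sums over lists.

  module _ {a} {X : Set a} where

    total : (X → ℕ) → List X → ℕ
    total f xs = sum (map f xs)

    total-++ : ∀ f xs ys → total f (xs ++ ys) ≡ total f xs + total f ys
    total-++ f xs ys = trans (cong sum (map-++ f xs ys)) (sum-++ (map f xs) (map f ys))

    total-cong : ∀ {f g} {xs} → All (λ x → f x ≡ g x) xs → total f xs ≡ total g xs
    total-cong []       = refl
    total-cong (h ∷ hs) = cong₂ _+_ h (total-cong hs)

    total-const : ∀ {f} {u} {xs} → All (λ x → f x ≡ u) xs → total f xs ≡ length xs * u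
    total-const []       = refl
    total-const (h ∷ hs) = cong₂ _+_ h (total-const hs)

    total-+ : ∀ f g xs → total (λ x → f x + g x) xs ≡ total f xs + total g xs
    total-+ f g []       = refl
    total-+ f g (x ∷ xs) = trans (cong (f x + g x +_) (total-+ f g xs)) (shuffle (f x) (g x) _ _)
      where
      shuffle : ∀ a b x y → a + b + (x + y) ≡ a + x + (b + y)
      shuffle = solve-∀

    -- Turns counting by `filter` into a sum of indicators, which can be reorganised along the
    -- enumeration of matchings.
    length-filter-≟ : ∀ (f : X → ℕ) p xs → length (filter (λ x → f x ≟ p) xs) ≡ total (λ x → δ (f x) p) xs
    length-filter-≟ f p []       = refl
    length-filter-≟ f p (x ∷ xs) with f x ≟ p
    ... | yes h = trans (cong length (filter-accept (λ x → f x ≟ p) h))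
      (cong₂ _+_ (sym (trans (cong (λ m → δ m p) h) (δ-refl p))) (length-filter-≟ f p xs))
      where
      δ-refl : ∀ p → δ p p ≡ 1
      δ-refl zero    = refl
      δ-refl (suc p) = δ-refl p
    ... | no  h = trans (cong length (filter-reject (λ x → f x ≟ p) h))
      (cong₂ _+_ (sym (δ-≢ (f x) p h)) (length-filter-≟ f p xs))
      where
      δ-≢ : ∀ m p → m ≢ p → δ m p ≡ 0
      δ-≢ zero    zero    h with () ← h refl
      δ-≢ zero    (suc p) h = refl
      δ-≢ (suc m) zero    h = refl
      δ-≢ (suc m) (suc p) h = δ-≢ m p (h ∘ cong suc)

  module _ {a b} {X : Set a} {Y : Set b} where

    total-map : ∀ f (g : X → Y) xs → total f (map g xs) ≡ total (f ∘ g) xs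
    total-map f g []       = refl
    total-map f g (x ∷ xs) = cong (f (g x) +_) (total-map f g xs)

    total-concatMap : ∀ f (g : X → List Y) xs → total f (concatMap g xs) ≡ total (total f ∘ g) xs
    total-concatMap f g []       = refl
    total-concatMap f g (x ∷ xs) =
      trans (total-++ f (g x) (concatMap g xs)) (cong (total f (g x) +_) (total-concatMap f g xs))

  -- The enumerated matchings and the recursions.

  select-All : ∀ {P : ℕ → Set} {xs} → All P xs → All (λ q → P (proj₁ q) × All P (proj₂ q)) (select xs)
  select-All []       = []
  select-All (h ∷ hs) = (h , hs) ∷ Allₚ.map⁺ (All.map (λ (u , us) → u , h ∷ us) (select-All hs))

  select-AllPairs : ∀ {xs} → AllPairs _<_ xs → All (AllPairs _<_ ∘ proj₂) (select xs)
  select-AllPairs []       = []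
  select-AllPairs (h ∷ hs) = hs ∷ Allₚ.map⁺
    (All.zipWith (λ ((_ , us) , vs) → us ∷ vs) (select-All h , select-AllPairs hs))

  select-length : ∀ xs → All (λ q → suc (length (proj₂ q)) ≡ length xs) (select xs)
  select-length []       = []
  select-length (x ∷ xs) = refl ∷ Allₚ.map⁺ (All.map (cong suc) (select-length xs))

  length-select : ∀ xs → length (select xs) ≡ length xs
  length-select []       = refl
  length-select (x ∷ xs) = cong suc (trans (length-map _ (select xs)) (length-select xs))

  -- Separates the partners of the first point that lie before the cut between `bs` and `as` from
  -- those behind it.
  total-select-++ : ∀ f bs as → total f (select (bs ++ as)) ≡
    total (λ q → f (proj₁ q , proj₂ q ++ as)) (select bs) + total (λ q → f (proj₁ q , bs ++ proj₂ q)) (select as)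
  total-select-++ f []       as = refl
  total-select-++ f (b ∷ bs) as = begin
      f (b , bs ++ as) + total f (map consᵇ (select (bs ++ as)))
    ≡⟨ cong (f (b , bs ++ as) +_) (trans (total-map f consᵇ (select (bs ++ as))) (total-select-++ (f ∘ consᵇ) bs as)) ⟩
      f (b , bs ++ as) + (total (λ q → f (proj₁ q , b ∷ proj₂ q ++ as)) (select bs) + Q)
    ≡⟨ sym (+-assoc (f (b , bs ++ as)) _ Q) ⟩
      f (b , bs ++ as) + total (λ q → f (proj₁ q , b ∷ proj₂ q ++ as)) (select bs) + Q
    ≡⟨ cong (λ u → f (b , bs ++ as) + u + Q) (sym (total-map (λ q → f (proj₁ q , proj₂ q ++ as)) consᵇ (select bs))) ⟩
      total (λ q → f (proj₁ q , proj₂ q ++ as)) (select (b ∷ bs)) + Q ∎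
    where
    open ≡-Reasoning
    consᵇ : ℕ × List ℕ → ℕ × List ℕ
    consᵇ q = proj₁ q , b ∷ proj₂ q
    Q = total (λ q → f (proj₁ q , b ∷ bs ++ proj₂ q)) (select as)

  total-matchings : ∀ (F : List (ℕ × ℕ) → ℕ) k x xs → total F (matchingsOf (suc k) (x ∷ xs)) ≡
    total (λ q → total (λ M → F ((x , proj₁ q) ∷ M)) (matchingsOf k (proj₂ q))) (select xs)
  total-matchings F k x xs = trans
    (total-concatMap F (λ q → map ((x , proj₁ q) ∷_) (matchingsOf k (proj₂ q))) (select xs))
    (total-cong (All.universal (λ q → total-map F ((x , proj₁ q) ∷_) (matchingsOf k (proj₂ q))) (select xs)))

  matchings-All : ∀ {P : ℕ → Set} k {xs} → All P xs → All (All (P ∘ proj₁)) (matchingsOf k xs)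
  matchings-All k       []       = [] ∷ []
  matchings-All zero    (h ∷ hs) = []
  matchings-All (suc k) (h ∷ hs) = Allₚ.concat⁺ (Allₚ.map⁺
    (All.map (λ (_ , us) → Allₚ.map⁺ (All.map (h ∷_) (matchings-All k us))) (select-All hs)))

  -- Pairs are listed with the smaller point first, so the right end alone decides whether a pair
  -- lies left of `t`.
  endsBelow : ℕ → List (ℕ × ℕ) → ℕ
  endsBelow t M = length (filter (λ ab → proj₂ ab <? t) M)

  endsBelow-accept : ∀ {t a b} M → b < t → endsBelow t ((a , b) ∷ M) ≡ suc (endsBelow t M)
  endsBelow-accept {t} {a} {b} M h = cong length (filter-accept (λ ab → proj₂ ab <? t) {a , b} {M} h)

  endsBelow-reject : ∀ {t a b} M → t ≤ b → endsBelow t ((a , b) ∷ M) ≡ endsBelow t M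
  endsBelow-reject {t} {a} {b} M h = cong length (filter-reject (λ ab → proj₂ ab <? t) {a , b} {M} (≤⇒≯ h))

  total-up : ∀ {a} {X : Set a} (f : X → ℕ → ℕ) p xs →
    total (λ x → up (f x) p) xs ≡ up (λ p → total (λ x → f x p) xs) p
  total-up f zero    xs = trans (total-const (All.universal (λ _ → refl) xs)) (*-zeroʳ (length xs))
  total-up f (suc p) xs = refl

  up-cong : ∀ {f g} → (∀ p → f p ≡ g p) → ∀ p → up f p ≡ up g p
  up-cong h zero    = refl
  up-cong h (suc p) = h p

  ≤-drop-pair : ∀ {m k} → suc (suc m) ≤ suc k + suc k → m ≤ k + k
  ≤-drop-pair {m} {k} h = s≤s⁻¹ (subst (suc m ≤_) (+-suc k k) (s≤s⁻¹ h))

  -- Induction on the fuel along the partner of the first point, as in `inside-first` and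
  -- `inside-suffix`. The length bound keeps the clause of `matchingsOf` for exhausted fuel out of
  -- reach.
  total-endsBelow : ∀ t k bs as p → All (_< t) bs → All (t ≤_) as → length bs + length as ≤ k + k →
    total (λ M → δ (endsBelow t M) p) (matchingsOf k (bs ++ as)) ≡ inside (length bs) (length as) p
  total-endsBelow t k [] [] p hb ha hk = +-identityʳ (δ 0 p)
  total-endsBelow t (suc k) [] (a ∷ as) p hb (_ ∷ ha) hk = begin
      total (λ M → δ (endsBelow t M) p) (matchingsOf (suc k) (a ∷ as))
    ≡⟨ total-matchings _ k a as ⟩
      total (λ q → total (λ M → δ (endsBelow t ((a , proj₁ q) ∷ M)) p) (matchingsOf k (proj₂ q))) (select as)
    ≡⟨ total-const (All.zipWith branch (select-All ha , select-length as)) ⟩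
      length (select as) * inside 0 (pred (length as)) p
    ≡⟨ cong (_* inside 0 (pred (length as)) p) (length-select as) ⟩
      length as * inside 0 (pred (length as)) p
    ≡⟨ sym (inside-suffix (length as) p) ⟩
      inside 0 (suc (length as)) p ∎
    where
    open ≡-Reasoning
    branch : ∀ {q} → (t ≤ proj₁ q × All (t ≤_) (proj₂ q)) × suc (length (proj₂ q)) ≡ length as →
      total (λ M → δ (endsBelow t ((a , proj₁ q) ∷ M)) p) (matchingsOf k (proj₂ q)) ≡ inside 0 (pred (length as)) p
    branch {y , ys} ((ty , tys) , len) = trans
      (total-cong (All.universal (λ M → cong (λ m → δ m p) (endsBelow-reject M ty)) (matchingsOf k ys)))
      (trans (total-endsBelow t k [] ys p [] tys (≤-drop-pair (subst (λ r → suc r ≤ suc k + suc k) (sym len) hk)))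
             (cong (λ r → inside 0 (pred r) p) len))
  total-endsBelow t (suc k) (b ∷ bs) as p (_ ∷ hb) ha hk = begin
      total (λ M → δ (endsBelow t M) p) (matchingsOf (suc k) (b ∷ bs ++ as))
    ≡⟨ total-matchings _ k b (bs ++ as) ⟩
      total G (select (bs ++ as))
    ≡⟨ total-select-++ G bs as ⟩
      total (λ q → G (proj₁ q , proj₂ q ++ as)) (select bs) + total (λ q → G (proj₁ q , bs ++ proj₂ q)) (select as)
    ≡⟨ cong₂ _+_ (total-const (All.zipWith inner (select-All hb , select-length bs)))
                 (total-const (All.zipWith outer (select-All ha , select-length as))) ⟩
      length (select bs) * up (inside (pred j) r) p + length (select as) * inside j (pred r) p
    ≡⟨ cong₂ (λ u v → u * up (inside (pred j) r) p + v * inside j (pred r) p) (length-select bs) (length-select as) ⟩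
      j * up (inside (pred j) r) p + r * inside j (pred r) p
    ≡⟨ sym (inside-first j r p) ⟩
      inside (suc j) r p ∎
    where
    open ≡-Reasoning
    j = length bs
    r = length as
    G : ℕ × List ℕ → ℕ
    G q = total (λ M → δ (endsBelow t ((b , proj₁ q) ∷ M)) p) (matchingsOf k (proj₂ q))
    inner : ∀ {q} → (proj₁ q < t × All (_< t) (proj₂ q)) × suc (length (proj₂ q)) ≡ j →
      G (proj₁ q , proj₂ q ++ as) ≡ up (inside (pred j) r) p
    -- The new pair ends below `t`, so the indicator becomes an `up`, which `total-up` moves out of
    -- the sum.
    inner {y , ys} ((yt , yst) , len) = trans
      (total-cong (All.universal (λ M → cong (λ m → δ m p) (endsBelow-accept M yt)) (matchingsOf k (ys ++ as))))
      (trans (total-up (λ M → δ (endsBelow t M)) p (matchingsOf k (ys ++ as)))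
      (up-cong (λ p′ → trans (total-endsBelow t k ys as p′ yst ha
        (≤-drop-pair (subst (λ m → suc (m + r) ≤ suc k + suc k) (sym len) hk))) (cong (λ m → inside (pred m) r p′) len)) p))
    outer : ∀ {q} → (t ≤ proj₁ q × All (t ≤_) (proj₂ q)) × suc (length (proj₂ q)) ≡ r →
      G (proj₁ q , bs ++ proj₂ q) ≡ inside j (pred r) p
    outer {y , ys} ((ty , tys) , len) = trans
      (total-cong (All.universal (λ M → cong (λ m → δ m p) (endsBelow-reject M ty)) (matchingsOf k (bs ++ ys))))
      (trans (total-endsBelow t k bs ys p hb tys
        (≤-drop-pair (subst (_≤ suc k + suc k) (cong suc (trans (cong (j +_) (sym len)) (+-suc j (length ys)))) hk)))
        (cong (λ m → inside j (pred m) p) len))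

  -- The other end `x` of the given pair runs through the list, and `bs` collects the points already
  -- passed. Since the list increases, `x` is a threshold between `bs` and the points after it, and
  -- the length of `bs` is the first index of `antidiagonal`.
  total-first : ∀ k p bs xs → AllPairs _<_ xs → All (λ x → All (_< x) bs) xs → length bs + length xs ≤ suc (k + k) →
    total (λ q → total (λ M → δ (endsBelow (proj₁ q) M) p) (matchingsOf k (bs ++ proj₂ q))) (select xs) ≡
    antidiagonal (length bs) (length xs) p
  total-first k p bs []       hx hbx hk = refl
  total-first k p bs (x ∷ xs) (x<xs ∷ hx) (bs<x ∷ hbx) hk = cong₂ _+_
    (total-endsBelow x k bs xs p bs<x (All.map <⇒≤ x<xs)
      (s≤s⁻¹ (subst (_≤ suc (k + k)) (+-suc (length bs) (length xs)) hk)))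
    (begin
      total G (map (λ q → proj₁ q , x ∷ proj₂ q) (select xs))
    ≡⟨ total-map G _ (select xs) ⟩
      total (λ q → total (λ M → δ (endsBelow (proj₁ q) M) p) (matchingsOf k (bs ++ x ∷ proj₂ q))) (select xs)
    ≡⟨ total-cong (All.universal (λ q → cong (λ zs → total (λ M → δ (endsBelow (proj₁ q) M) p) (matchingsOf k zs))
         (sym (++-assoc bs [ x ] (proj₂ q)))) (select xs)) ⟩
      total (λ q → total (λ M → δ (endsBelow (proj₁ q) M) p) (matchingsOf k ((bs ∷ʳ x) ++ proj₂ q))) (select xs)
    ≡⟨ total-first k p (bs ∷ʳ x) xs hx
         (All.zipWith (λ (u , v) → Allₚ.++⁺ u (v ∷ [])) (hbx , x<xs))
         (subst (_≤ suc (k + k)) (trans (+-suc (length bs) (length xs)) (cong (_+ length xs) (sym len))) hk) ⟩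
      antidiagonal (length (bs ∷ʳ x)) (length xs) p
    ≡⟨ cong (λ j → antidiagonal j (length xs) p) len ⟩
      antidiagonal (suc (length bs)) (length xs) p ∎)
    where
    open ≡-Reasoning
    G : ℕ × List ℕ → ℕ
    G q = total (λ M → δ (endsBelow (proj₁ q) M) p) (matchingsOf k (bs ++ proj₂ q))
    len : length (bs ∷ʳ x) ≡ suc (length bs)
    len = trans (length-++ bs) (+-comm (length bs) 1)

  -- Configurations, split at the first point.

  numContained-first : ∀ {x y M} → All (λ ab → x < proj₁ ab) M → numContained ((x , y) , (x , y) ∷ M) ≡ endsBelow y M
  numContained-first {x} {y} {M} h = trans
    (cong length (filter-reject (contained? (x , y)) {x , y} {M} λ (x<x , _) → <-irrefl refl x<x))
    (go h)
    where
    go : ∀ {M} → All (λ ab → x < proj₁ ab) M → length (filter (contained? (x , y)) M) ≡ endsBelow y M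
    go []                          = refl
    -- The left condition `x < a` always holds, so the right ends decide.
    go (_∷_ {a , b} {M} x<a hs) with b <? y
    ... | yes b<y = trans (cong length (filter-accept (contained? (x , y)) {a , b} {M} (x<a , b<y)))
                          (trans (cong suc (go hs)) (sym (endsBelow-accept {a = a} M b<y)))
    ... | no  b≮y = trans (cong length (filter-reject (contained? (x , y)) {a , b} {M} (b≮y ∘ proj₂)))
                          (trans (go hs) (sym (endsBelow-reject {a = a} M (≮⇒≥ b≮y))))

  numContained-later : ∀ {x y g M} → x < proj₁ g → numContained (g , (x , y) ∷ M) ≡ numContained (g , M)
  numContained-later {x} {y} {g} {M} h = cong length (filter-reject (contained? g) {x , y} {M} (λ (g<x , _) → <-asym h g<x))

  totalGiven : ℕ → List (ℕ × ℕ) → ℕ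
  totalGiven p M = total (λ g → δ (numContained (g , M)) p) M

  -- Either the first pair is the given one, or a later pair is, which cannot contain a pair
  -- starting before it.
  totalGiven-∷ : ∀ p {x y M} → All (λ ab → x < proj₁ ab) M →
    totalGiven p ((x , y) ∷ M) ≡ δ (endsBelow y M) p + totalGiven p M
  totalGiven-∷ p {M = M} h = cong₂ _+_ (cong (λ m → δ m p) (numContained-first h))
    (total-cong (All.map (λ {g} x<g → cong (λ m → δ m p) (numContained-later {g = g} {M = M} x<g)) h))

  total-configurations : ∀ k p xs → AllPairs _<_ xs → length xs ≡ k + k →
    total (totalGiven p) (matchingsOf k xs) ≡ config k p
  total-configurations zero    p []       hx hk = refl
  total-configurations (suc k) p (x ∷ xs) (x<xs ∷ hx) hk = begin
      total (totalGiven p) (matchingsOf (suc k) (x ∷ xs))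
    ≡⟨ total-matchings (totalGiven p) k x xs ⟩
      total (λ q → total (λ M → totalGiven p ((x , proj₁ q) ∷ M)) (matchingsOf k (proj₂ q))) (select xs)
    ≡⟨ total-cong (All.map split (select-All x<xs)) ⟩
      total (λ q → first q + rest q) (select xs)
    ≡⟨ total-+ first rest (select xs) ⟩
      total first (select xs) + total rest (select xs)
    ≡⟨ cong₂ _+_ (total-first k p [] xs hx (All.universal (λ _ → []) xs) (≤-reflexive len))
                 (total-const (All.zipWith (λ {q} → later {q}) (select-AllPairs hx , select-length xs))) ⟩
      antidiagonal 0 (length xs) p + length (select xs) * config k p
    ≡⟨ cong₂ (λ u v → antidiagonal 0 u p + v * config k p) len (trans (length-select xs) len) ⟩
      config (suc k) p ∎
    where
    open ≡-Reasoning
    first rest : ℕ × List ℕ → ℕ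
    first q = total (λ M → δ (endsBelow (proj₁ q) M) p) (matchingsOf k (proj₂ q))
    rest  q = total (totalGiven p) (matchingsOf k (proj₂ q))
    len : length xs ≡ suc (k + k)
    len = suc-injective (trans hk (cong suc (+-suc k k)))
    split : ∀ {q} → x < proj₁ q × All (x <_) (proj₂ q) →
      total (λ M → totalGiven p ((x , proj₁ q) ∷ M)) (matchingsOf k (proj₂ q)) ≡ first q + rest q
    split {q} (_ , h) = trans (total-cong (All.map (totalGiven-∷ p) (matchings-All k h)))
                              (total-+ _ (totalGiven p) (matchingsOf k (proj₂ q)))
    later : ∀ {q} → AllPairs _<_ (proj₂ q) × suc (length (proj₂ q)) ≡ length xs → rest q ≡ config k p
    later {q} (h , l) = total-configurations k p (proj₂ q) h (suc-injective (trans l len))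

  C≡config : ∀ n p → C n p ≡ config n p
  C≡config n p = begin
      C n p
    ≡⟨ length-filter-≟ numContained p (configurations n) ⟩
      total (λ z → δ (numContained z) p) (configurations n)
    ≡⟨ total-concatMap _ _ (matchings n) ⟩
      total (λ M → total (λ z → δ (numContained z) p) (map (λ g → g , M) M)) (matchings n)
    ≡⟨ total-cong (All.universal (λ M → total-map _ (λ g → g , M) M) (matchings n)) ⟩
      total (totalGiven p) (matchings n)
    ≡⟨ total-configurations n p (points n)
         (AllPairsₚ.map⁺ (AllPairsₚ.applyUpTo⁺₁ id (n + n) (λ i<j _ → s≤s i<j)))
         (trans (length-map suc (upTo (n + n))) (length-upTo (n + n))) ⟩
      config n p ∎
    where open ≡-Reasoning

open Counting using (config; config-rec; config-zero; C≡config; oddFactorial)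
open import Data.Nat as ℕ using (ℕ; zero; suc; z≤n; s≤s; _!; _∸_) renaming (_≤_ to _≤ᴺ_; _<_ to _<ᴺ_)
import Data.Nat.Properties as ℕₚ
open import Data.Integer as ℤ using (+_)
import Data.Integer.Properties as ℤₚ
open import Data.Rational hiding (_≤_; _<_)
open import Data.Rational.Properties
import Data.Rational.Unnormalised as ℚᵘ
import Data.Rational.Unnormalised.Properties as ℚᵘ
open import Relation.Binary.Definitions using (tri<; tri≈; tri>)
open import Relation.Nullary.Decidable using (dec⇒maybe)
open import Tactic.RingSolver using (solve-∀)
open import Tactic.RingSolver.Core.AlmostCommutativeRing using (AlmostCommutativeRing; fromCommutativeRing)

-- Natural numbers inside the rationals.

ι : ℕ → ℚ
ι n = + n / 1

-- Fractions in `ℚ` are normalised; passing to unnormalised ones reduces the laws of `ι` to integer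
-- identities between cross products.
toℚᵘ-/ : ∀ m k .{{_ : ℕ.NonZero k}} → toℚᵘ (+ m / k) ℚᵘ.≃ (+ m ℚᵘ./ k)
toℚᵘ-/ m (suc k) = toℚᵘ-fromℚᵘ (ℚᵘ.mkℚᵘ (+ m) k)

ι-+ : ∀ m n → ι (m ℕ.+ n) ≡ ι m + ι n
ι-+ m n = toℚᵘ-injective (ℚᵘ.≃-trans (toℚᵘ-/ (m ℕ.+ n) 1) (ℚᵘ.≃-trans (ℚᵘ.*≡* eq)
  (ℚᵘ.≃-sym (ℚᵘ.≃-trans (toℚᵘ-homo-+ (ι m) (ι n)) (ℚᵘ.+-cong (toℚᵘ-/ m 1) (toℚᵘ-/ n 1))))))
  where
  eq : + (m ℕ.+ n) ℤ.* + 1 ≡ (+ m ℤ.* + 1 ℤ.+ + n ℤ.* + 1) ℤ.* + 1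
  eq = cong (ℤ._* + 1) (sym (cong₂ ℤ._+_ (ℤₚ.*-identityʳ (+ m)) (ℤₚ.*-identityʳ (+ n))))

ι-* : ∀ m n → ι (m ℕ.* n) ≡ ι m * ι n
ι-* m n = toℚᵘ-injective (ℚᵘ.≃-trans (toℚᵘ-/ (m ℕ.* n) 1) (ℚᵘ.≃-trans (ℚᵘ.*≡* (cong (ℤ._* + 1) (ℤₚ.pos-* m n)))
  (ℚᵘ.≃-sym (ℚᵘ.≃-trans (toℚᵘ-homo-* (ι m) (ι n)) (ℚᵘ.*-cong (toℚᵘ-/ m 1) (toℚᵘ-/ n 1))))))

ι-/ : ∀ m k .{{_ : ℕ.NonZero k}} → ι k * (+ m / k) ≡ ι m
ι-/ m (suc k) = toℚᵘ-injective (ℚᵘ.≃-trans (toℚᵘ-homo-* (ι (suc k)) (+ m / suc k))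
  (ℚᵘ.≃-trans (ℚᵘ.*-cong (toℚᵘ-/ (suc k) 1) (toℚᵘ-/ m (suc k)))
  (ℚᵘ.≃-trans (ℚᵘ.*≡* eq) (ℚᵘ.≃-sym (toℚᵘ-/ m 1)))))
  where
  eq : + suc k ℤ.* + m ℤ.* + 1 ≡ + m ℤ.* (+ 1 ℤ.* + suc k)
  eq = trans (ℤₚ.*-identityʳ _) (trans (ℤₚ.*-comm (+ suc k) (+ m)) (cong (+ m ℤ.*_) (sym (ℤₚ.*-identityˡ (+ suc k)))))

ℚ-ring : AlmostCommutativeRing _ _
ℚ-ring = fromCommutativeRing +-*-commutativeRing (λ x → dec⇒maybe (0ℚ ≟ x))

ι-cancel : ∀ k .{{_ : ℕ.NonZero k}} {x y} → ι k * x ≡ ι k * y → x ≡ y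
ι-cancel k {x} {y} h = trans (sym (recover x)) (trans (cong (+ 1 / k *_) h) (recover y))
  where
  recover : ∀ z → + 1 / k * (ι k * z) ≡ z
  recover z = trans (sym (*-assoc (+ 1 / k) (ι k) z))
    (trans (cong (_* z) (trans (*-comm (+ 1 / k) (ι k)) (ι-/ 1 k))) (*-identityˡ z))

ι-cancel-0 : ∀ n {x} → ι (suc n) * x ≡ 0ℚ → x ≡ 0ℚ
ι-cancel-0 n h = ι-cancel (suc n) (trans h (sym (*-zeroʳ (ι (suc n)))))

-- Products of series in y and z.

sumTo-cong : ∀ n {f g} → (∀ a → a ≤ᴺ n → f a ≡ g a) → sumTo n f ≡ sumTo n g
sumTo-cong zero    h = h 0 z≤n
sumTo-cong (suc n) h = cong₂ _+_ (sumTo-cong n (λ a a≤n → h a (ℕₚ.m≤n⇒m≤1+n a≤n))) (h (suc n) ℕₚ.≤-refl)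

sumTo-+ : ∀ n f g → sumTo n (λ a → f a + g a) ≡ sumTo n f + sumTo n g
sumTo-+ zero    f g = refl
sumTo-+ (suc n) f g = trans (cong (_+ (f (suc n) + g (suc n))) (sumTo-+ n f g)) (swap (sumTo n f) (sumTo n g) (f (suc n)) (g (suc n)))
  where
  swap : ∀ a b x y → (a + b) + (x + y) ≡ (a + x) + (b + y)
  swap = solve-∀ ℚ-ring

sumTo-* : ∀ n x f → x * sumTo n f ≡ sumTo n (λ a → x * f a)
sumTo-* zero    x f = refl
sumTo-* (suc n) x f = trans (*-distribˡ-+ x _ _) (cong (_+ x * f (suc n)) (sumTo-* n x f))

sumTo-head : ∀ n f → sumTo (suc n) f ≡ f 0 + sumTo n (f ∘ suc)
sumTo-head zero    f = refl
sumTo-head (suc n) f = trans (cong (_+ f (suc (suc n))) (sumTo-head n f)) (+-assoc (f 0) _ _)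

module ℚ[[z]] = Series +-*-commutativeRing
-- Series in y over ℚ[[z]]: the carrier unfolds to `PS` and the equality to `_≈S_`.
module ℚ[[y,z]] = Series ℚ[[z]].seriesRing
module P = CommutativeRing ℚ[[y,z]].seriesRing
module PL = CommutativeRingLemmas ℚ[[y,z]].seriesRing

sumTo-✶₁ : ∀ (f g : ℕ → ℚ) j → sumTo j (λ b → f b * g (j ∸ b)) ≡ (f ℚ[[z]].✶ g) j
sumTo-✶₁ f g zero    = refl
sumTo-✶₁ f g (suc j) = trans (sumTo-head j _) (cong (λ u → f 0 * g (suc j) + u) (sumTo-✶₁ (f ∘ suc) g j))

-- Makes the commutative ring laws available for `_⊛_`. The convolution in z is identified first,
-- then the one in y.
⊛≈✶ : ∀ F G → (F ⊛ G) ≈S (F P.* G)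
⊛≈✶ F G i j = trans (sumTo-cong i (λ a _ → sumTo-✶₁ (F a) (G (i ∸ a)) j)) (outer F i)
  where
  outer : ∀ F i → sumTo i (λ a → (F a ℚ[[z]].✶ G (i ∸ a)) j) ≡ (F P.* G) i j
  outer F zero    = refl
  outer F (suc i) = trans (sumTo-head i _) (cong (λ u → (F 0 ℚ[[z]].✶ G (suc i)) j + u) (outer (F ∘ suc) i))

-- Derivations and square roots.

module _ (w : ℕ → ℕ → ℚ) (w-additive : ∀ {i a j b} → a ≤ᴺ i → b ≤ᴺ j → w i j ≡ w a b + w (i ∸ a) (j ∸ b)) where

  weighted : PS → PS
  weighted F i j = w i j * F i j

  -- In each product of coefficients the weight splits as the sum of the weights of the two factors,
  -- so `weighted` is a derivation.
  weighted-leibniz : ∀ F G → weighted (F ⊛ G) ≈S ((weighted F ⊛ G) ⊕ (F ⊛ weighted G))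
  weighted-leibniz F G i j = begin
      w i j * (F ⊛ G) i j
    ≡⟨ sumTo-* i (w i j) _ ⟩
      sumTo i (λ a → w i j * sumTo j (λ b → F a b * G (i ∸ a) (j ∸ b)))
    ≡⟨ sumTo-cong i (λ a a≤i → trans (sumTo-* j (w i j) _) (trans (sumTo-cong j (λ b b≤j →
         trans (cong (_* (F a b * G (i ∸ a) (j ∸ b))) (w-additive a≤i b≤j)) (split (w a b) _ (F a b) _)))
         (sumTo-+ j _ _))) ⟩
      sumTo i (λ a → sumTo j (λ b → weighted F a b * G (i ∸ a) (j ∸ b)) +
                     sumTo j (λ b → F a b * weighted G (i ∸ a) (j ∸ b)))
    ≡⟨ sumTo-+ i _ _ ⟩
      (weighted F ⊛ G) i j + (F ⊛ weighted G) i j ∎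
    where
    open ≡-Reasoning
    split : ∀ u v x y → (u + v) * (x * y) ≡ (u * x) * y + x * (v * y)
    split = solve-∀ ℚ-ring

mulY : PS → PS
mulY F zero    j = 0ℚ
mulY F (suc i) j = F i j

mulZ : PS → PS
mulZ F i zero    = 0ℚ
mulZ F i (suc j) = F i j

const-* : ∀ x G → (const x P.* G) ≈S (λ i j → x * G i j)
const-* x G i j = trans (ℚ[[y,z]].✶-head G (λ _ _ → refl) i j)
                        (ℚ[[z]].✶-head (G i) (λ _ → refl) j)

yS-* : ∀ G → (yS P.* G) ≈S mulY G
yS-* G zero    j = ℚ[[z]].✶-zeroˡ (G 0) j
yS-* G (suc i) j = trans (ℚ[[y,z]].✶-tail {yS} G (λ _ → refl) i j)
  (trans (ℚ[[y,z]].✶-head {λ i → yS (suc i)} G (λ _ _ → refl) i j)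
  (trans (ℚ[[z]].✶-head (G i) (λ _ → refl) j) (*-identityˡ (G i j))))

zS-* : ∀ G → (zS P.* G) ≈S mulZ G
zS-* G i zero    = trans (ℚ[[y,z]].✶-head {zS} G (λ _ _ → refl) i 0) (*-zeroˡ (G i 0))
zS-* G i (suc j) = trans (ℚ[[y,z]].✶-head {zS} G (λ _ _ → refl) i (suc j))
  (trans (ℚ[[z]].✶-tail {zS 0} (G i) refl j)
  (trans (ℚ[[z]].✶-head {λ j → zS 0 (suc j)} (G i) (λ _ → refl) j) (*-identityˡ (G i j))))

oneS≈1 : oneS ≈S P.1#
oneS≈1 zero    zero    = refl
oneS≈1 zero    (suc j) = refl
oneS≈1 (suc i) j       = refl

-- `m` is the coefficientwise form of multiplication by `X`; the instances are y, 2z and 2yz.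
module _ {X : PS} {m : PS → PS} (X-* : ∀ G → (X P.* G) ≈S m G) where

  [1⊖X]-* : ∀ G → ((oneS ⊖ X) P.* G) ≈S (λ i j → G i j - m G i j)
  [1⊖X]-* G i j = trans (P.*-congʳ {G} {oneS ⊖ X} {P.1# P.- X} (λ i j → cong (_- X i j) (oneS≈1 i j)) i j)
    (trans (PL.[1-x]*g X G i j) (cong (λ u → G i j - u) (X-* G i j)))

  module _ {w : ℕ → ℕ → ℚ} (w-additive : ∀ {i a j b} → a ≤ᴺ i → b ≤ᴺ j → w i j ≡ w a b + w (i ∸ a) (j ∸ b))
           (w-origin : w 0 0 ≡ 0ℚ) {k} (X-homogeneous : ∀ i j → w i j * X i j ≡ k * X i j)
           {S} (S²≈1⊖X : (S ⊛ S) ≈S (oneS ⊖ X)) where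

    private
      U : PS
      U = weighted w w-additive S

    -- The constant 1 is killed because the weight is 0 at the origin, and `X` is an eigenvector.
    weighted-1⊖X : weighted w w-additive (oneS ⊖ X) ≈S (const (- k) P.* X)
    weighted-1⊖X i j = begin
        w i j * (oneS i j - X i j)
      ≡⟨ split (w i j) (oneS i j) (X i j) ⟩
        w i j * oneS i j - w i j * X i j
      ≡⟨ cong₂ _-_ (origin i j) (X-homogeneous i j) ⟩
        0ℚ - k * X i j
      ≡⟨ collect k (X i j) ⟩
        - k * X i j
      ≡⟨ sym (const-* (- k) X i j) ⟩
        (const (- k) P.* X) i j ∎
      where
      open ≡-Reasoning
      split : ∀ u x y → u * (x - y) ≡ u * x - u * y
      split = solve-∀ ℚ-ring
      collect : ∀ u x → 0ℚ - u * x ≡ - u * x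
      collect = solve-∀ ℚ-ring
      origin : ∀ i j → w i j * oneS i j ≡ 0ℚ
      origin zero    zero    = trans (cong (_* 1ℚ) w-origin) (*-zeroˡ 1ℚ)
      origin zero    (suc j) = *-zeroʳ (w 0 (suc j))
      origin (suc i) j       = *-zeroʳ (w (suc i) j)

    -- Here X is an eigenvector of the derivation ∂ = weighted w with eigenvalue k, so that S² = 1 − X
    -- gives 2 (1 − X) ∂S = S ∂(1 − X) = − k X S.
    sqrt-equation : ∀ i j → (U i j - m U i j) + (U i j - m U i j) ≡ - k * m S i j
    sqrt-equation i j = begin
        (U i j - m U i j) + (U i j - m U i j)
      ≡⟨ sym (cong₂ _+_ ([1⊖X]-* U i j) ([1⊖X]-* U i j)) ⟩
        (((oneS ⊖ X) P.* U) P.+ ((oneS ⊖ X) P.* U)) i j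
      ≡⟨ PL.sqrt-derivation {S} {oneS ⊖ X} {U} {const (- k) P.* X} S*S≈ leibniz i j ⟩
        ((const (- k) P.* X) P.* S) i j
      ≡⟨ P.*-assoc (const (- k)) X S i j ⟩
        (const (- k) P.* (X P.* S)) i j
      ≡⟨ const-* (- k) (X P.* S) i j ⟩
        - k * (X P.* S) i j
      ≡⟨ cong (- k *_) (X-* S i j) ⟩
        - k * m S i j ∎
      where
      open ≡-Reasoning
      S*S≈ : (S P.* S) ≈S (oneS ⊖ X)
      S*S≈ i j = trans (sym (⊛≈✶ S S i j)) (S²≈1⊖X i j)
      leibniz : ((U P.* S) P.+ (S P.* U)) ≈S (const (- k) P.* X)
      leibniz i j = begin
          (U P.* S) i j + (S P.* U) i j
        ≡⟨ sym (cong₂ _+_ (⊛≈✶ U S i j) (⊛≈✶ S U i j)) ⟩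
          (U ⊛ S) i j + (S ⊛ U) i j
        ≡⟨ sym (weighted-leibniz w w-additive S S i j) ⟩
          w i j * (S ⊛ S) i j
        ≡⟨ cong (w i j *_) (S²≈1⊖X i j) ⟩
          w i j * (oneS ⊖ X) i j
        ≡⟨ weighted-1⊖X i j ⟩
          (const (- k) P.* X) i j ∎

-- The Euler operators and the coefficients of the two square roots.

degY degZ : ℕ → ℕ → ℚ
degY i j = ι i
degZ i j = ι j

ι-∸ : ∀ {a i} → a ≤ᴺ i → ι i ≡ ι a + ι (i ∸ a)
ι-∸ {a} {i} a≤i = trans (cong ι (sym (ℕₚ.m+[n∸m]≡n a≤i))) (ι-+ a (i ∸ a))

degY-additive : ∀ {i a j b} → a ≤ᴺ i → b ≤ᴺ j → degY i j ≡ degY a b + degY (i ∸ a) (j ∸ b)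
degY-additive a≤i _ = ι-∸ a≤i

degZ-additive : ∀ {i a j b} → a ≤ᴺ i → b ≤ᴺ j → degZ i j ≡ degZ a b + degZ (i ∸ a) (j ∸ b)
degZ-additive _ b≤j = ι-∸ b≤j

[2z]-coeff : ∀ i j → (twoS ⊛ zS) i j ≡ ι 2 * zS i j
[2z]-coeff i j = trans (⊛≈✶ twoS zS i j) (const-* (ι 2) zS i j)

[2yz]-coeff : ∀ i j → (twoS ⊛ (yS ⊛ zS)) i j ≡ ι 2 * mulY zS i j
[2yz]-coeff i j = trans (⊛≈✶ twoS (yS ⊛ zS) i j) (trans (const-* (ι 2) (yS ⊛ zS) i j)
  (cong (ι 2 *_) (trans (⊛≈✶ yS zS i j) (yS-* zS i j))))

[2z]-* : ∀ G → ((twoS ⊛ zS) P.* G) ≈S (λ i j → ι 2 * mulZ G i j)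
[2z]-* G i j = trans (P.*-congʳ {G} (⊛≈✶ twoS zS) i j) (trans (P.*-assoc twoS zS G i j)
  (trans (const-* (ι 2) (zS P.* G) i j) (cong (ι 2 *_) (zS-* G i j))))

[2yz]-* : ∀ G → ((twoS ⊛ (yS ⊛ zS)) P.* G) ≈S (λ i j → ι 2 * mulY (mulZ G) i j)
[2yz]-* G i j = trans (P.*-congʳ {G} (⊛≈✶ twoS (yS ⊛ zS)) i j) (trans (P.*-assoc twoS (yS ⊛ zS) G i j)
  (trans (const-* (ι 2) ((yS ⊛ zS) P.* G) i j) (cong (ι 2 *_)
  (trans (P.*-congʳ {G} (⊛≈✶ yS zS) i j) (trans (P.*-assoc yS zS G i j)
  (trans (yS-* (zS P.* G) i j) (mulY-cong i)))))))
  where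
  mulY-cong : ∀ i → mulY (zS P.* G) i j ≡ mulY (mulZ G) i j
  mulY-cong zero    = refl
  mulY-cong (suc i) = zS-* G i j

[2z]-degY : ∀ i j → degY i j * (twoS ⊛ zS) i j ≡ 0ℚ * (twoS ⊛ zS) i j
[2z]-degY i j rewrite [2z]-coeff i j = go i
  where
  go : ∀ i → ι i * (ι 2 * zS i j) ≡ 0ℚ * (ι 2 * zS i j)
  go zero    = refl
  go (suc i) = trans (*-zeroʳ (ι (suc i))) (sym (*-zeroʳ 0ℚ))

[2z]-degZ : ∀ i j → degZ i j * (twoS ⊛ zS) i j ≡ 1ℚ * (twoS ⊛ zS) i j
[2z]-degZ i j rewrite [2z]-coeff i j = go i j
  where
  go : ∀ i j → ι j * (ι 2 * zS i j) ≡ 1ℚ * (ι 2 * zS i j)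
  go zero    zero          = refl
  go zero    (suc zero)    = refl
  go zero    (suc (suc j)) = trans (*-zeroʳ (ι (suc (suc j)))) (sym (*-zeroʳ 1ℚ))
  go (suc i) j             = trans (*-zeroʳ (ι j)) (sym (*-zeroʳ 1ℚ))

[2yz]-degY : ∀ i j → degY i j * (twoS ⊛ (yS ⊛ zS)) i j ≡ 1ℚ * (twoS ⊛ (yS ⊛ zS)) i j
[2yz]-degY i j rewrite [2yz]-coeff i j = go i
  where
  go : ∀ i → ι i * (ι 2 * mulY zS i j) ≡ 1ℚ * (ι 2 * mulY zS i j)
  go zero          = refl
  go (suc zero)    = refl
  go (suc (suc i)) = trans (*-zeroʳ (ι (suc (suc i)))) (sym (*-zeroʳ 1ℚ))

[2yz]-degZ : ∀ i j → degZ i j * (twoS ⊛ (yS ⊛ zS)) i j ≡ 1ℚ * (twoS ⊛ (yS ⊛ zS)) i j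
[2yz]-degZ i j rewrite [2yz]-coeff i j = go i j
  where
  go : ∀ i j → ι j * (ι 2 * mulY zS i j) ≡ 1ℚ * (ι 2 * mulY zS i j)
  go zero          j             = trans (*-zeroʳ (ι j)) (sym (*-zeroʳ 1ℚ))
  go (suc zero)    zero          = refl
  go (suc zero)    (suc zero)    = refl
  go (suc zero)    (suc (suc j)) = trans (*-zeroʳ (ι (suc (suc j)))) (sym (*-zeroʳ 1ℚ))
  go (suc (suc i)) j             = trans (*-zeroʳ (ι j)) (sym (*-zeroʳ 1ℚ))

-- Solves `sqrt-equation` for the next coefficient: `u` is that coefficient times its degree, `s`
-- the preceding one and `x` the degree of `s`.
halve : ∀ u x s → (u - ι 2 * (x * s)) + (u - ι 2 * (x * s)) ≡ - 1ℚ * (ι 2 * s) → u ≡ (ι 2 * x - 1ℚ) * s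
halve u x s h = ι-cancel 2 (trans (double u x s) (trans (cong (λ v → v + ι 2 * (ι 2 * (x * s))) h) (collect x s)))
  where
  double : ∀ u x s → ι 2 * u ≡ (u - ι 2 * (x * s)) + (u - ι 2 * (x * s)) + ι 2 * (ι 2 * (x * s))
  double = solve-∀ ℚ-ring
  collect : ∀ x s → - 1ℚ * (ι 2 * s) + ι 2 * (ι 2 * (x * s)) ≡ ι 2 * ((ι 2 * x - 1ℚ) * s)
  collect = solve-∀ ℚ-ring

vanish : ∀ u {v} → (u - ι 2 * 0ℚ) + (u - ι 2 * 0ℚ) ≡ v → v ≡ 0ℚ → u ≡ 0ℚ
vanish u h h′ = ι-cancel 2 (trans (double u) (trans h h′))
  where
  double : ∀ u → ι 2 * u ≡ (u - ι 2 * 0ℚ) + (u - ι 2 * 0ℚ)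
  double = solve-∀ ℚ-ring

-- As 2z has y-degree 0, the y-equation reads (1 - 2z) y∂S/∂y = 0, so `S` is free of y by induction
-- on the z-degree. The z-equation gives the recurrence.
sqrt-[1-2z] : ∀ S → IsSqrt S (oneS ⊖ (twoS ⊛ zS)) →
  (∀ i j → S (suc i) j ≡ 0ℚ) × (∀ j → ι (suc j) * S 0 (suc j) ≡ (ι 2 * ι j - 1ℚ) * S 0 j)
sqrt-[1-2z] S (_ , hS) = (λ i j → ι-cancel-0 i (y-free (suc i) j)) , recurrence
  where
  y-eq : ∀ i j → _
  y-eq = sqrt-equation [2z]-* degY-additive refl {0ℚ} [2z]-degY {S} hS
  z-eq : ∀ i j → _
  z-eq = sqrt-equation [2z]-* degZ-additive refl {1ℚ} [2z]-degZ {S} hS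
  y-free : ∀ i j → ι i * S i j ≡ 0ℚ
  y-free i zero    = vanish (ι i * S i 0) (y-eq i 0) (*-zeroˡ (ι 2 * 0ℚ))
  y-free i (suc j) = vanish (ι i * S i (suc j))
    (trans (cong (λ u → (ι i * S i (suc j) - ι 2 * u) + (ι i * S i (suc j) - ι 2 * u)) (sym (y-free i j))) (y-eq i (suc j)))
    (*-zeroˡ (ι 2 * S i j))
  recurrence : ∀ j → ι (suc j) * S 0 (suc j) ≡ (ι 2 * ι j - 1ℚ) * S 0 j
  recurrence j = halve (ι (suc j) * S 0 (suc j)) (ι j) (S 0 j) (z-eq 0 (suc j))

-- Multiplication by 2yz contributes nothing on the axes, so the y-equation kills one axis and the
-- z-equation the other. Elsewhere the z-equation relates neighbours along a diagonal.
sqrt-[1-2yz] : ∀ S → IsSqrt S (oneS ⊖ (twoS ⊛ (yS ⊛ zS))) →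
  (∀ i → S (suc i) 0 ≡ 0ℚ) × (∀ j → S 0 (suc j) ≡ 0ℚ) ×
  (∀ i j → ι (suc j) * S (suc i) (suc j) ≡ (ι 2 * ι j - 1ℚ) * S i j)
sqrt-[1-2yz] S (_ , hS) =
  (λ i → ι-cancel-0 i (vanish (ι (suc i) * S (suc i) 0) (y-eq (suc i) 0) refl)) ,
  (λ j → ι-cancel-0 j (vanish (ι (suc j) * S 0 (suc j)) (z-eq 0 (suc j)) refl)) ,
  (λ i j → halve (ι (suc j) * S (suc i) (suc j)) (ι j) (S i j) (z-eq (suc i) (suc j)))
  where
  y-eq : ∀ i j → _
  y-eq = sqrt-equation [2yz]-* degY-additive refl {1ℚ} [2yz]-degY {S} hS
  z-eq : ∀ i j → _
  z-eq = sqrt-equation [2yz]-* degZ-additive refl {1ℚ} [2yz]-degZ {S} hS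

-- The recurrence descends along a parallel to the main diagonal until it meets an axis away from
-- the origin.
off-diagonal : ∀ (S : PS) → (∀ i → S (suc i) 0 ≡ 0ℚ) → (∀ j → S 0 (suc j) ≡ 0ℚ) →
  (∀ i j → ι (suc j) * S (suc i) (suc j) ≡ (ι 2 * ι j - 1ℚ) * S i j) → ∀ i j → i ≢ j → S i j ≡ 0ℚ
off-diagonal S h₁ h₂ h zero    zero    i≢j with () ← i≢j refl
off-diagonal S h₁ h₂ h zero    (suc j) i≢j = h₂ j
off-diagonal S h₁ h₂ h (suc i) zero    i≢j = h₁ i
off-diagonal S h₁ h₂ h (suc i) (suc j) i≢j = ι-cancel-0 j (trans (h i j)
  (trans (cong ((ι 2 * ι j - 1ℚ) *_) (off-diagonal S h₁ h₂ h i j (i≢j ∘ cong suc))) (*-zeroʳ (ι 2 * ι j - 1ℚ))))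

-- Minus the coefficient of degree n + 1 in √(1 - 2z); the constant term, of opposite sign, is left
-- out.
coeff : ℕ → ℚ
coeff n = (+ oddFactorial n / (suc n !)) {{ (suc n) ℕₚ.!≢0 }}

coeff-eq : ∀ n x → ι (suc n !) * x ≡ ι (oddFactorial n) → x ≡ coeff n
coeff-eq n x h = ι-cancel (suc n !) {{ (suc n) ℕₚ.!≢0 }} (trans h (sym (ι-/ (oddFactorial n) (suc n !) {{ (suc n) ℕₚ.!≢0 }})))

ι-suc : ∀ n → ι (suc n) ≡ 1ℚ + ι n
ι-suc n = ι-+ 1 n

-- After multiplication by the factorial this is the recursion of `oddFactorial`. The sign comes
-- from the first step, whose factor is -1, and `s 0` selects the branch of the root.
sqrt-recurrence : ∀ (s : ℕ → ℚ) → s 0 ≡ 1ℚ → (∀ n → ι (suc n) * s (suc n) ≡ (ι 2 * ι n - 1ℚ) * s n) →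
  ∀ n → - s (suc n) ≡ coeff n
sqrt-recurrence s s0 rec n = coeff-eq n (- s (suc n)) (go n)
  where
  open ≡-Reasoning
  go : ∀ n → ι (suc n !) * - s (suc n) ≡ ι (oddFactorial n)
  go zero = begin
      1ℚ * - s 1
    ≡⟨ negate (s 1) ⟩
      - (ι 1 * s 1)
    ≡⟨ cong -_ (trans (rec 0) (cong ((ι 2 * ι 0 - 1ℚ) *_) s0)) ⟩
      1ℚ ∎
    where
    negate : ∀ x → 1ℚ * - x ≡ - (1ℚ * x)
    negate = solve-∀ ℚ-ring
  go (suc n) = begin
      ι (suc (suc n) !) * - s (suc (suc n))
    ≡⟨ cong (_* - s (suc (suc n))) (ι-* (suc (suc n)) (suc n !)) ⟩
      ι (suc (suc n)) * ι (suc n !) * - s (suc (suc n))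
    ≡⟨ pull (ι (suc (suc n))) (ι (suc n !)) (s (suc (suc n))) ⟩
      - (ι (suc n !) * (ι (suc (suc n)) * s (suc (suc n))))
    ≡⟨ cong (λ u → - (ι (suc n !) * u)) (rec (suc n)) ⟩
      - (ι (suc n !) * ((ι 2 * ι (suc n) - 1ℚ) * s (suc n)))
    ≡⟨ push (ι (suc n !)) (ι 2 * ι (suc n) - 1ℚ) (s (suc n)) ⟩
      (ι 2 * ι (suc n) - 1ℚ) * (ι (suc n !) * - s (suc n))
    -- 2(n + 1) - 1 = 2n + 1 is the next odd factor.
    ≡⟨ cong₂ _*_ odd (go n) ⟩
      ι (suc (n ℕ.+ n)) * ι (oddFactorial n)
    ≡⟨ sym (ι-* (suc (n ℕ.+ n)) (oddFactorial n)) ⟩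
      ι (oddFactorial (suc n)) ∎
    where
    pull : ∀ a b x → a * b * - x ≡ - (b * (a * x))
    pull = solve-∀ ℚ-ring
    push : ∀ a b x → - (a * (b * x)) ≡ b * (a * - x)
    push = solve-∀ ℚ-ring
    lemma : ∀ x → ι 2 * (1ℚ + x) - 1ℚ ≡ 1ℚ + (x + x)
    lemma = solve-∀ ℚ-ring
    odd : ι 2 * ι (suc n) - 1ℚ ≡ ι (suc (n ℕ.+ n))
    odd = trans (cong (λ u → ι 2 * u - 1ℚ) (ι-suc n)) (trans (lemma (ι n))
      (sym (trans (ι-suc (n ℕ.+ n)) (cong (λ u → 1ℚ + u) (ι-+ n n)))))

-- The generating function and the comparison of coefficients.

n!*Cgf : ∀ p n → ι (n !) * Cgf p n ≡ ι (config n p)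
n!*Cgf p n with (1 ℕ.≤? n) ×-dec (p ℕ.<? n)
... | yes _ = trans (ι-/ (C n p) (n !) {{ n ℕₚ.!≢0 }}) (cong ι (C≡config n p))
-- The default 0 is the right value: p < n would imply 1 ≤ n, so here n ≤ p and `config` vanishes.
... | no  h = trans (*-zeroʳ (ι (n !))) (cong ι (sym (config-zero n p (ℕₚ.≮⇒≥ λ p<n → h (ℕₚ.≤-trans (s≤s z≤n) p<n , p<n)))))

[1-2z]Cgf : PS
[1-2z]Cgf i j = Cgf i j - ι 2 * mulZ Cgf i j

-- Splitting (n + 1)! as (n + 1) n! turns the factor 2 of 2z into the 2(n + 1) of `config-rec`.
scaled-[1-2z]Cgf : ∀ p n → ι (suc n !) * [1-2z]Cgf p (suc n) ≡ ι (config (suc n) p) - ι (suc n ℕ.+ suc n) * ι (config n p)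
scaled-[1-2z]Cgf p n = begin
    ι (suc n !) * (Cgf p (suc n) - ι 2 * Cgf p n)
  ≡⟨ split (ι (suc n !)) (Cgf p (suc n)) (Cgf p n) ⟩
    ι (suc n !) * Cgf p (suc n) - ι 2 * ι (suc n !) * Cgf p n
  ≡⟨ cong₂ (λ u v → u - ι 2 * v * Cgf p n) (n!*Cgf p (suc n)) (ι-* (suc n) (n !)) ⟩
    ι (config (suc n) p) - ι 2 * (ι (suc n) * ι (n !)) * Cgf p n
  ≡⟨ collect (ι (config (suc n) p)) (ι (suc n)) (ι (n !)) (Cgf p n) ⟩
    ι (config (suc n) p) - (ι (suc n) + ι (suc n)) * (ι (n !) * Cgf p n)
  ≡⟨ cong₂ (λ u v → ι (config (suc n) p) - u * v) (sym (ι-+ (suc n) (suc n))) (n!*Cgf p n) ⟩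
    ι (config (suc n) p) - ι (suc n ℕ.+ suc n) * ι (config n p) ∎
  where
  open ≡-Reasoning
  split : ∀ a x y → a * (x - ι 2 * y) ≡ a * x - ι 2 * a * y
  split = solve-∀ ℚ-ring
  collect : ∀ x a b y → x - ι 2 * (a * b) * y ≡ x - (a + a) * (b * y)
  collect = solve-∀ ℚ-ring

-- `config-rec` cancels the `config n p` term. What remains does not depend on `p`, so the factor 1
-- - y will annihilate it inside the support.
[1-2z]Cgf-≤ : ∀ {p n} → p ≤ᴺ n → [1-2z]Cgf p (suc n) ≡ coeff n
[1-2z]Cgf-≤ {p} {n} p≤n = coeff-eq n _ (trans (scaled-[1-2z]Cgf p n) (begin
    ι (config (suc n) p) - ι (suc n ℕ.+ suc n) * ι (config n p)
  ≡⟨ cong (λ u → u - ι (suc n ℕ.+ suc n) * ι (config n p)) (begin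
      ι (config (suc n) p)
    ≡⟨ cong ι (config-rec n p p≤n) ⟩
      ι ((suc n ℕ.+ suc n) ℕ.* config n p ℕ.+ oddFactorial n)
    ≡⟨ ι-+ ((suc n ℕ.+ suc n) ℕ.* config n p) (oddFactorial n) ⟩
      ι ((suc n ℕ.+ suc n) ℕ.* config n p) + ι (oddFactorial n)
    ≡⟨ cong (_+ ι (oddFactorial n)) (ι-* (suc n ℕ.+ suc n) (config n p)) ⟩
      ι (suc n ℕ.+ suc n) * ι (config n p) + ι (oddFactorial n) ∎) ⟩
    ι (suc n ℕ.+ suc n) * ι (config n p) + ι (oddFactorial n) - ι (suc n ℕ.+ suc n) * ι (config n p)
  ≡⟨ cancel (ι (suc n ℕ.+ suc n) * ι (config n p)) (ι (oddFactorial n)) ⟩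
    ι (oddFactorial n) ∎))
  where
  open ≡-Reasoning
  cancel : ∀ x y → x + y - x ≡ y
  cancel = solve-∀ ℚ-ring

[1-2z]Cgf-> : ∀ {p n} → n <ᴺ p → [1-2z]Cgf p (suc n) ≡ 0ℚ
[1-2z]Cgf-> {p} {n} n<p = ι-cancel (suc n !) {{ (suc n) ℕₚ.!≢0 }} (trans (scaled-[1-2z]Cgf p n)
  (trans (cong₂ (λ u v → ι u - ι (suc n ℕ.+ suc n) * ι v) (config-zero (suc n) p n<p) (config-zero n p (ℕₚ.<⇒≤ n<p)))
  (collect (ι (suc n !)) (ι (suc n ℕ.+ suc n)))))
  where
  collect : ∀ a b → 0ℚ - b * 0ℚ ≡ a * 0ℚ
  collect = solve-∀ ℚ-ring

lhs-coeff : (Cgf ⊛ ((oneS ⊖ (twoS ⊛ zS)) ⊛ (oneS ⊖ yS))) ≈S (λ i j → [1-2z]Cgf i j - mulY [1-2z]Cgf i j)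
lhs-coeff i j = begin
    (Cgf ⊛ (Z ⊛ Y)) i j
  ≡⟨ ⊛≈✶ Cgf (Z ⊛ Y) i j ⟩
    (Cgf P.* (Z ⊛ Y)) i j
  ≡⟨ P.*-congˡ {Cgf} (⊛≈✶ Z Y) i j ⟩
    (Cgf P.* (Z P.* Y)) i j
  ≡⟨ P.*-comm Cgf (Z P.* Y) i j ⟩
    ((Z P.* Y) P.* Cgf) i j
  ≡⟨ P.*-congʳ {Cgf} (P.*-comm Z Y) i j ⟩
    ((Y P.* Z) P.* Cgf) i j
  ≡⟨ P.*-assoc Y Z Cgf i j ⟩
    (Y P.* (Z P.* Cgf)) i j
  ≡⟨ P.*-congˡ {Y} ([1⊖X]-* [2z]-* Cgf) i j ⟩
    (Y P.* [1-2z]Cgf) i j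
  ≡⟨ [1⊖X]-* yS-* [1-2z]Cgf i j ⟩
    [1-2z]Cgf i j - mulY [1-2z]Cgf i j ∎
  where
  open ≡-Reasoning
  Z = oneS ⊖ (twoS ⊛ zS)
  Y = oneS ⊖ yS

theorem13 : (S₁ S₂ : PS) →
    IsSqrt S₁ (oneS ⊖ (twoS ⊛ (yS ⊛ zS))) →
    IsSqrt S₂ (oneS ⊖ (twoS ⊛ zS)) →
    (Cgf ⊛ ((oneS ⊖ (twoS ⊛ zS)) ⊛ (oneS ⊖ yS))) ≈S (S₁ ⊖ S₂)
theorem13 S₁ S₂ h₁ h₂ i j = trans (lhs-coeff i j) (compare i j)
  where
  S₂-high = proj₁ (sqrt-[1-2z] S₂ h₂)
  S₂-coeff : ∀ n → - S₂ 0 (suc n) ≡ coeff n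
  S₂-coeff = sqrt-recurrence (S₂ 0) (proj₁ h₂) (proj₂ (sqrt-[1-2z] S₂ h₂))
  S₁-facts = sqrt-[1-2yz] S₁ h₁
  S₁-off : ∀ i j → i ≢ j → S₁ i j ≡ 0ℚ
  S₁-off = off-diagonal S₁ (proj₁ S₁-facts) (proj₁ (proj₂ S₁-facts)) (proj₂ (proj₂ S₁-facts))
  S₁-coeff : ∀ n → - S₁ (suc n) (suc n) ≡ coeff n
  S₁-coeff = sqrt-recurrence (λ n → S₁ n n) (proj₁ h₁) (λ n → proj₂ (proj₂ S₁-facts) n n)
  negate : ∀ x → 0ℚ - - x ≡ x - 0ℚ
  negate = solve-∀ ℚ-ring
  compare : ∀ i j → [1-2z]Cgf i j - mulY [1-2z]Cgf i j ≡ S₁ i j - S₂ i j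
  compare zero    zero    = sym (cong₂ _-_ (proj₁ h₁) (proj₁ h₂))
  -- In the row of y-degree 0 the factor 1 - y has nothing to subtract, and the value is that of
  -- `- S₂`.
  compare zero    (suc n) = begin
      [1-2z]Cgf 0 (suc n) - 0ℚ
    ≡⟨ cong (_- 0ℚ) (trans ([1-2z]Cgf-≤ {0} {n} z≤n) (sym (S₂-coeff n))) ⟩
      - S₂ 0 (suc n) - 0ℚ
    ≡⟨ +-comm (- S₂ 0 (suc n)) 0ℚ ⟩
      0ℚ - S₂ 0 (suc n)
    ≡⟨ cong (_- S₂ 0 (suc n)) (sym (S₁-off 0 (suc n) λ ())) ⟩
      S₁ 0 (suc n) - S₂ 0 (suc n) ∎
    where open ≡-Reasoning
  compare (suc i) zero    = sym (cong₂ _-_ (S₁-off (suc i) 0 λ ()) (S₂-high i 0))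
  -- Here `S₂` is 0. For i < n two equal values cancel; for i = n only the subtracted one is nonzero
  -- and yields the diagonal of `S₁`; for i > n everything is 0.
  compare (suc i) (suc n) with ℕₚ.<-cmp i n
  ... | tri< i<n i≢n _ = trans
    (cong₂ _-_ ([1-2z]Cgf-≤ {suc i} {n} i<n) ([1-2z]Cgf-≤ {i} {n} (ℕₚ.<⇒≤ i<n)))
    (trans (+-inverseʳ (coeff n))
    (sym (cong₂ _-_ (S₁-off (suc i) (suc n) (i≢n ∘ ℕₚ.suc-injective)) (S₂-high i (suc n)))))
  ... | tri≈ _ refl _ = trans
    (cong₂ _-_ ([1-2z]Cgf-> {suc i} {i} ℕₚ.≤-refl) (trans ([1-2z]Cgf-≤ {i} {i} ℕₚ.≤-refl) (sym (S₁-coeff i))))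
    (trans (negate (S₁ (suc i) (suc i))) (cong (λ u → S₁ (suc i) (suc i) - u) (sym (S₂-high i (suc i)))))
  ... | tri> _ i≢n n<i = trans
    (cong₂ _-_ ([1-2z]Cgf-> {suc i} {n} (ℕₚ.<-trans n<i (ℕₚ.n<1+n i))) ([1-2z]Cgf-> {i} {n} n<i))
    (sym (cong₂ _-_ (S₁-off (suc i) (suc n) (i≢n ∘ ℕₚ.suc-injective)) (S₂-high i (suc n))))
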